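{- Let $d\ge1$, $P\subseteq\mathbb R\times[d]$ and $k\in[d]$. The colorful Helly number of $(P,\mathcal C_{\equiv}(P))$ with respect to $k$-intersecting satisfies $h_{ck}(P,\mathcal C_{\equiv}(P))\le 2d-k+1$. That is, for any finite families $\mathcal C_1,\dots,\mathcal C_{2d-k+1}\subseteq\mathcal C_{\equiv}(P)$ such that every colorful tuple $C_1\in\mathcal C_1,\dots,C_{2d-k+1}\in\mathcal C_{2d-k+1}$ is $k$-intersecting, some family $\mathcal C_i$ is $k$-intersecting.
   Context: $[d]=\{1,\dots,d\}$. A (separated) $d$-interval is a set $I=\bigcup_{i\in[d]}\{(x,i): x\in I^{(i)}\}\subseteq\mathbb R\times[d]$ with each $I^{(i)}\subseteq\mathbb R$ convex (possibly empty); points $(x,i)$ lie in the $i$-th level. For $P\subseteq\mathbb R\times[d]$, $\mathcal C_{\equiv}(P)=\{I\cap P: I \text{ a } d\text{ -interval}\}$. A collection of sets of $\mathcal C_{\equiv}(P)$ $k$-intersects (is $k$-intersecting) if its intersection contains at least $k$ points of $P$ lying in $k$ distinct levels. $h_{ck}(P,\mathcal C_{\equiv}(P))$ is the minimal $n$ such that for any $n$ finite families $\mathcal F_1,\dots,\mathcal F_n\subseteq\mathcal C_{\equiv}(P)$ in which every colorful $n$-tuple ($C_i\in\mathcal F_i$) is $k$-intersecting, some $\mathcal F_i$ is $k$-intersecting. -}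

module Defs where

open import Data.Fin using (Fin)
open import Data.Nat as ℕ using (ℕ)
open import Data.Product using (_×_; _,_; ∃; proj₁; proj₂)
open import Data.Product.Relation.Binary.Pointwise.NonDependent using (Pointwise)
open import Data.Rational as ℚ using (ℚ)
open import Data.Sum using (_⊎_)
open import Function using (_∘_; _⇔_)
open import Function.Definitions using (Injective)
open import Level using (0ℓ; suc)
open import Relation.Binary.Core using (Rel)
open import Relation.Binary.PropositionalEquality using (_≡_)
open import Relation.Nullary using (¬_)
open import Relation.Unary using (Pred; _∈_; _⊆_; _∩_; _≐_; ⋂; Satisfiable)

-- Two-sided Dedekind cuts of ℚ, with equality of reals given by _≈_.
record ℝ : Set₁ where
  field
    lower upper     : Pred ℚ 0ℓ
    lower-inhabited : Satisfiable lower
    upper-inhabited : Satisfiable upper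
    lower-rounded   : ∀ q → lower q ⇔ ∃ λ r → q ℚ.< r × lower r
    upper-rounded   : ∀ q → upper q ⇔ ∃ λ r → r ℚ.< q × upper r
    disjoint        : ∀ q → ¬ (lower q × upper q)
    located         : ∀ q r → q ℚ.< r → lower q ⊎ upper r

open ℝ public

infix 4 _≤_ _≈_ _≈ₚ_

_≤_ : Rel ℝ 0ℓ
x ≤ y = lower x ⊆ lower y

_≈_ : Rel ℝ 0ℓ
x ≈ y = x ≤ y × y ≤ x

-- Since x ≤ y ≤ x whenever x ≈ y, a convex predicate automatically respects _≈_.
Convex : Pred ℝ 0ℓ → Set₁
Convex X = ∀ x y z → x ∈ X → z ∈ X → x ≤ y → y ≤ z → y ∈ X

Point : ℕ → Set₁
Point d = ℝ × Fin d

level : ∀ {d} → Point d → Fin d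
level = proj₂

_≈ₚ_ : ∀ {d} → Rel (Point d) 0ℓ
_≈ₚ_ = Pointwise _≈_ _≡_

record DInterval (d : ℕ) : Set₁ where
  field
    part   : Fin d → Pred ℝ 0ℓ
    convex : ∀ i → Convex (part i)

  points : Pred (Point d) 0ℓ
  points (x , i) = x ∈ part i

open DInterval public

SetSystem : ℕ → Set₂
SetSystem d = Pred (Pred (Point d) 0ℓ) (suc 0ℓ)

C≡ : ∀ {d} → Pred (Point d) 0ℓ → SetSystem d
C≡ {d} P C = ∃ λ (I : DInterval d) → C ≐ (points I ∩ P)

KIntersecting : ∀ {d} → Pred (Point d) 0ℓ → ℕ → {J : Set} →
                (J → Pred (Point d) 0ℓ) → Set₁
KIntersecting {d} P k {J} C =
  ∃ λ (p : Fin k → Point d) →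
    (∀ j → p j ∈ (P ∩ ⋂ J C)) × Injective _≡_ _≡_ (level ∘ p)

-- Families are nonempty: an empty family would make the hypothesis on colorful
-- tuples vacuous. Repeated members are harmless, as only intersections matter.
record FiniteFamily {d : ℕ} (𝒞 : SetSystem d) : Set₁ where
  field
    size     : ℕ
    nonempty : 1 ℕ.≤ size
    member   : Fin size → Pred (Point d) 0ℓ
    member∈  : ∀ a → member a ∈ 𝒞

open FiniteFamily public

ColorfulHelly : ∀ {d} → Pred (Point d) 0ℓ → SetSystem d → ℕ → ℕ → Set₁
ColorfulHelly P 𝒞 k n =
  (F : Fin n → FiniteFamily 𝒞) →
  (∀ (c : ∀ i → Fin (size (F i))) → KIntersecting P k (λ i → member (F i) (c i))) →
  ∃ λ i → KIntersecting P k (member (F i))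

record IsColorfulHellyNumber {d : ℕ} (P : Pred (Point d) 0ℓ) (𝒞 : SetSystem d)
                             (k h : ℕ) : Set₁ where
  field
    positive : 1 ℕ.≤ h
    helly    : ColorfulHelly P 𝒞 k h
    minimal  : ∀ n → 1 ℕ.≤ n → ColorfulHelly P 𝒞 k n → h ℕ.≤ n

{-# OPTIONS --safe #-}

-- A finite family is k-intersecting iff at least k levels contain a point
-- common to all its members, so a family that is not has bad levels outside
-- any d − k given ones. Two families that are bad on the same level have a pair
-- of members disjoint on it, killing it (colorful Helly on the line). Suppose no
-- family is k-intersecting, and that r ≤ d − k levels have been killed using 2r
-- families: more than d − r families are left, each with a bad level among the
-- d − r remaining ones, so two of them share one, which they then kill. After
-- d − k + 1 rounds fewer than k levels are left to the colorful tuple built.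
module Submission where

open import Defs
open import Axiom.ExcludedMiddle using (ExcludedMiddle)
open import Data.Nat using (ℕ; _+_; _*_; _∸_) renaming (_≤_ to _≤ₙ_)
open import Data.Product using (_×_; ∃)
open import Level using (0ℓ; suc)
open import Relation.Binary.Definitions using (_Respects_)
open import Relation.Unary using (Pred)

open import Axiom.DoubleNegationElimination using (em⇒dne)
open import Data.Empty using (⊥; ⊥-elim)
open import Data.Fin as Fin using (Fin; splitAt; fromℕ<)
import Data.Fin.Properties as Fin
open import Data.Nat as ℕ using (z≤n; s≤s)
import Data.Nat.Properties as ℕ
open import Data.Product using (∃₂; _,_; proj₁; proj₂)
import Data.Rational as ℚ
import Data.Rational.Properties as ℚ
open import Data.Sum using (_⊎_; inj₁; inj₂)
open import Data.Vec.Functional using (_∷_; _++_; [])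
open import Function using (_∘_; flip; Equivalence)
open import Function.Definitions using (Injective)
open import Level using (Lift; lift)
open import Relation.Binary.Core using (Rel)
open import Relation.Binary.Definitions using (Transitive; Total; tri<; tri≈; tri>)
open import Relation.Binary.PropositionalEquality
  using (_≡_; _≢_; refl; sym; trans; cong; subst; module ≡-Reasoning)
open import Relation.Nullary using (¬_; yes; no; contradiction)
open import Relation.Nullary.Decidable using (map′; ¬?)
open import Relation.Unary using (_∈_)

-- Finite counting: avoiding given values, and pigeonhole.

missed : ∀ {m n} → m ℕ.< n → (f : Fin m → Fin n) → ∃ λ x → ∀ b → x ≢ f b
missed {m} {n} m<n f with Fin.any? (λ x → Fin.all? (λ b → ¬? (x Fin.≟ f b)))
... | yes found = found
-- With no value missed, choosing preimages would inject `Fin n` into `Fin m`.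
... | no none   = contradiction (Fin.injective⇒≤ section-injective) (ℕ.<⇒≱ m<n)
  where
  preimage : ∀ x → ∃ λ b → x ≡ f b
  preimage x with Fin.any? (λ b → x Fin.≟ f b)
  ... | yes hit = hit
  ... | no miss = contradiction (x , λ b eq → miss (b , eq)) none

  section-injective : Injective _≡_ _≡_ (proj₁ ∘ preimage)
  section-injective {x} {y} eq =
    trans (proj₂ (preimage x)) (trans (cong f eq) (sym (proj₂ (preimage y))))

-- Greedy choice: each new value joins the list to be avoided, which yields distinctness and
-- avoidance together. It serves to pick levels outside the killed ones and families outside the
-- used ones.
avoiding : ∀ {m n} k (f : Fin m → Fin n) → m + k ≤ₙ n →
           ∃ λ (g : Fin k → Fin n) → Injective _≡_ _≡_ g × (∀ a b → g a ≢ f b)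
avoiding ℕ.zero f _ = [] , (λ { {()} }) , λ ()
avoiding {m} {n} (ℕ.suc k) f m+1+k≤n
  with 1+m+k≤n ← subst (_≤ₙ n) (ℕ.+-suc m k) m+1+k≤n
  with x , x∉f ← missed (ℕ.m+n≤o⇒m≤o (ℕ.suc m) 1+m+k≤n) f
  with g , g-inj , g∉xf ← avoiding k (x ∷ f) 1+m+k≤n
  = x ∷ g , inj , avoids
  where
  inj : Injective _≡_ _≡_ (x ∷ g)
  inj {Fin.zero}  {Fin.zero}  _  = refl
  inj {Fin.zero}  {Fin.suc b} eq = contradiction (sym eq) (g∉xf b Fin.zero)
  inj {Fin.suc a} {Fin.zero}  eq = contradiction eq (g∉xf a Fin.zero)
  inj {Fin.suc a} {Fin.suc b} eq = cong Fin.suc (g-inj eq)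

  avoids : ∀ a b → (x ∷ g) a ≢ f b
  avoids Fin.zero    b = x∉f b
  avoids (Fin.suc a) b = g∉xf a (Fin.suc b)

-- Pigeonhole applied to `f ++ g`: injectivity rules out a collision inside `f`, avoidance one
-- between `f` and `g`.
pigeonhole-avoiding : ∀ {r t n} {f : Fin r → Fin n} {g : Fin t → Fin n} →
                      n ℕ.< r + t → Injective _≡_ _≡_ f → (∀ a b → g a ≢ f b) →
                      ∃₂ λ a b → a ≢ b × g a ≡ g b
pigeonhole-avoiding {r} {t} {f = f} {g} n<r+t f-inj g∉f
  with i , j , i<j , eq ← Fin.pigeonhole n<r+t (f ++ g)
  with splitAt r i in ieq | splitAt r j in jeq
... | inj₁ a | inj₁ b = contradiction
  (trans (sym (Fin.splitAt⁻¹-↑ˡ ieq)) (trans (cong (Fin._↑ˡ t) (f-inj eq)) (Fin.splitAt⁻¹-↑ˡ jeq)))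
  (Fin.<⇒≢ i<j)
... | inj₁ a | inj₂ b = contradiction (sym eq) (g∉f b a)
... | inj₂ a | inj₁ b = contradiction eq (g∉f a b)
... | inj₂ a | inj₂ b = a , b , a≢b , eq
  where
  a≢b : a ≢ b
  a≢b refl = Fin.<⇒≢ i<j (trans (sym (Fin.splitAt⁻¹-↑ʳ ieq)) (Fin.splitAt⁻¹-↑ʳ jeq))

-- Changing one entry of a dependent tuple.

module _ {n} {X : Fin n → Set} where

  update : (∀ j → X j) → ∀ j → X j → ∀ i → X i
  update c j x i with j Fin.≟ i
  ... | yes refl = x
  ... | no _     = c i

  update-updates : ∀ c j x → update c j x j ≡ x
  update-updates c j x with j Fin.≟ j
  ... | yes refl = refl
  ... | no j≢j   = contradiction refl j≢j

  update-minimal : ∀ c j x {i} → j ≢ i → update c j x i ≡ c i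
  update-minimal c j x {i} j≢i with j Fin.≟ i
  ... | yes j≡i = contradiction j≡i j≢i
  ... | no _    = refl

-- Finite extrema, lower cuts, least natural numbers.

extremum : ∀ {a ℓ} {A : Set a} {_≲_ : Rel A ℓ} → Transitive _≲_ → Total _≲_ →
           ∀ {n} → 1 ≤ₙ n → (f : Fin n → A) → ∃ λ i → ∀ j → f j ≲ f i
extremum {_≲_ = _≲_} ≲-trans ≲-total = go
  where
  ≲-refl : ∀ {x} → x ≲ x
  ≲-refl {x} with ≲-total x x
  ... | inj₁ p = p
  ... | inj₂ p = p

  go : ∀ {n} → 1 ≤ₙ n → (f : Fin n → _) → ∃ λ i → ∀ j → f j ≲ f i
  go {ℕ.suc ℕ.zero} _ f = Fin.zero , λ { Fin.zero → ≲-refl }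
  go {ℕ.suc (ℕ.suc n)} _ f with i , max ← go (s≤s z≤n) (f ∘ Fin.suc)
    with ≲-total (f Fin.zero) (f (Fin.suc i))
  ... | inj₁ f0≲fi = Fin.suc i , λ { Fin.zero → f0≲fi ; (Fin.suc j) → max j }
  ... | inj₂ fi≲f0 = Fin.zero , λ { Fin.zero → ≲-refl ; (Fin.suc j) → ≲-trans (max j) fi≲f0 }

≤-trans : Transitive _≤_
≤-trans x≤y y≤z q = y≤z (x≤y q)

lower-closed : ∀ x {q r} → q ℚ.< r → lower x r → lower x q
lower-closed x {q} {r} q<r xr = Equivalence.from (lower-rounded x q) (r , q<r , xr)

-- Turns an upper bound for the Helly number into its existence; the property is not decidable,
-- hence `em`.
least : ∀ {ℓ} → ExcludedMiddle ℓ → {Q : ℕ → Set ℓ} → ∀ m → Q m →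
        ∃ λ h → Q h × h ≤ₙ m × (∀ n → Q n → h ≤ₙ n)
least em ℕ.zero Q0 = 0 , Q0 , z≤n , λ _ _ → z≤n
least em {Q} (ℕ.suc m) Qm with em {Q 0}
... | yes Q0 = 0 , Q0 , z≤n , λ _ _ → z≤n
... | no ¬Q0 with h , Qh , h≤m , min ← least em {Q ∘ ℕ.suc} m Qm =
  ℕ.suc h , Qh , s≤s h≤m , λ { ℕ.zero Q0 → contradiction Q0 ¬Q0 ; (ℕ.suc n) Qn → s≤s (min n Qn) }

-- Classical comparison of reals.

module Classical (em : ExcludedMiddle (suc 0ℓ)) where

  em₀ : ExcludedMiddle 0ℓ
  em₀ = map′ Level.lower lift (em {Lift (suc 0ℓ) _})

  dne : ∀ {A : Set₁} → ¬ ¬ A → A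
  dne = em⇒dne em

  -- A rational `q` below `x` but not below `y` bounds the lower cut of `y`, which therefore lies in
  -- that of `x`.
  ≤-total : Total _≤_
  ≤-total x y with em₀ {∃ λ q → lower x q × ¬ lower y q}
  ... | no none = inj₁ λ {q} xq → em⇒dne em₀ λ ¬yq → none (q , xq , ¬yq)
  ... | yes (q , xq , ¬yq) = inj₂ y≤x
    where
    y≤x : y ≤ x
    y≤x {r} yr with ℚ.<-cmp r q
    ... | tri< r<q _ _  = lower-closed x r<q xq
    ... | tri≈ _ refl _ = xq
    ... | tri> _ _ q<r  = contradiction (lower-closed y q<r yr) ¬yq

  -- Colorful Helly for two families on the line.

  module _ {m n} {A : Fin m → Pred ℝ 0ℓ} {B : Fin n → Pred ℝ 0ℓ} {Q : Pred ℝ 0ℓ}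
    (1≤m : 1 ≤ₙ m) (1≤n : 1 ≤ₙ n)
    -- Convexity is relative to `Q` because members of `C≡ P` are traces on `P`: a point in between
    -- belongs to the member only if it lies in `P`.
    (A-convex : ∀ a {x y z} → Q y → x ∈ A a → z ∈ A a → x ≤ y → y ≤ z → y ∈ A a)
    (B-convex : ∀ b {x y z} → Q y → x ∈ B b → z ∈ B b → x ≤ y → y ≤ z → y ∈ B b)
    where

    -- With p a b ∈ A a ∩ B b, the point r = minₐ max_b p a b lies in every B b
    -- as soon as each column b has an entry ≥ r; otherwise the maximum of a
    -- column lying below r is in every A a.
    colorful-helly-line : (∀ a b → ∃ λ x → Q x × x ∈ A a × x ∈ B b) →
      (∃ λ x → Q x × (∀ a → x ∈ A a)) ⊎ (∃ λ x → Q x × (∀ b → x ∈ B b))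
    colorful-helly-line common = result
      where
      p : Fin m → Fin n → ℝ
      p a b = proj₁ (common a b)

      pQ : ∀ a b → Q (p a b)
      pQ a b = proj₁ (proj₂ (common a b))

      pA : ∀ a b → p a b ∈ A a
      pA a b = proj₁ (proj₂ (proj₂ (common a b)))

      pB : ∀ a b → p a b ∈ B b
      pB a b = proj₂ (proj₂ (proj₂ (common a b)))

      rowMax : ∀ a → ∃ λ b → ∀ b′ → p a b′ ≤ p a b
      rowMax a = extremum {_≲_ = _≤_} (λ {x} {y} {z} → ≤-trans {x} {y} {z}) ≤-total 1≤n (p a)

      b* : Fin m → Fin n
      b* a = proj₁ (rowMax a)

      minimax : ∃ λ a → ∀ a′ → p a (b* a) ≤ p a′ (b* a′)
      minimax = extremum {_≲_ = flip _≤_} (λ {x} {y} {z} y≤x z≤y → ≤-trans {z} {y} {x} z≤y y≤x)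
                  (flip ≤-total) 1≤m λ a → p a (b* a)

      a₀ : Fin m
      a₀ = proj₁ minimax

      r : ℝ
      r = p a₀ (b* a₀)

      result : _
      result with em₀ {∃ λ b → ∀ a → ¬ (r ≤ p a b)}
      ... | no none = inj₂ (r , pQ a₀ (b* a₀) , r∈B)
        where
        r∈B : ∀ b → r ∈ B b
        r∈B b with a , r≤p ← em⇒dne em₀ {∃ λ a → r ≤ p a b} (λ ¬a → none (b , λ a r≤p → ¬a (a , r≤p))) =
          B-convex b (pQ a₀ (b* a₀)) (pB a₀ b) (pB a b) (proj₂ (rowMax a₀) b) r≤p
      ... | yes (b , below) = inj₁ (s , pQ a₁ b , s∈A)
        where
        colMax : ∃ λ a → ∀ a′ → p a′ b ≤ p a b
        colMax = extremum {_≲_ = _≤_} (λ {x} {y} {z} → ≤-trans {x} {y} {z}) ≤-total 1≤m λ a → p a b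

        a₁ : Fin m
        a₁ = proj₁ colMax

        s : ℝ
        s = p a₁ b

        s≤r : s ≤ r
        s≤r with ≤-total s r
        ... | inj₁ s≤r = s≤r
        ... | inj₂ r≤s = λ _ → ⊥-elim (below a₁ r≤s)

        s∈A : ∀ a → s ∈ A a
        s∈A a = A-convex a (pQ a₁ b) (pA a b) (pA a (b* a)) (proj₂ colMax a)
                  (≤-trans {s} {r} {p a (b* a)} s≤r (proj₂ minimax a))

  -- Members of `C≡ P` on a single level.

  module _ {d} (P : Pred (Point d) 0ℓ) where

    Common : Fin d → {J : Set} → (J → Pred (Point d) 0ℓ) → Set₁
    Common i C = ∃ λ x → P (x , i) × (∀ j → (x , i) ∈ C j)

    DisjointAt : Fin d → Pred (Point d) 0ℓ → Pred (Point d) 0ℓ → Set₁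
    DisjointAt i C D = ∀ x → (x , i) ∈ C → (x , i) ∈ D → ⊥

    member-convex : ∀ {C} → C≡ P C → ∀ {i x y z} → P (y , i) →
                    (x , i) ∈ C → (z , i) ∈ C → x ≤ y → y ≤ z → (y , i) ∈ C
    member-convex (I , C⊆ , ⊆C) {i} Py x∈C z∈C x≤y y≤z =
      ⊆C (convex I i _ _ _ (proj₁ (C⊆ x∈C)) (proj₁ (C⊆ z∈C)) x≤y y≤z , Py)

    member⊆P : ∀ {C} → C≡ P C → ∀ {x} → x ∈ C → P x
    member⊆P (_ , C⊆ , _) x∈C = proj₂ (C⊆ x∈C)

    -- Contrapositive of `colorful-helly-line`, with `Q` the trace of `P` on level `i`.
    separate : (F G : FiniteFamily (C≡ P)) → ∀ {i} →
               ¬ Common i (member F) → ¬ Common i (member G) →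
               ∃₂ λ a b → DisjointAt i (member F a) (member G b)
    separate F G {i} badF badG = dne λ none →
      neither (colorful-helly-line (nonempty F) (nonempty G)
        (λ a → member-convex (member∈ F a)) (λ b → member-convex (member∈ G b))
        (λ a b → dne λ ¬common → none (a , b , λ x x∈F x∈G →
          ¬common (x , member⊆P (member∈ F a) x∈F , x∈F , x∈G))))
      where
      neither : ¬ (Common i (member F) ⊎ Common i (member G))
      neither (inj₁ c) = badF c
      neither (inj₂ c) = badG c

    -- Killing levels round by round.

    module _ {k n} (k≤d : k ≤ₙ d) (d+d<n+k : d + d ℕ.< n + k) (F : Fin n → FiniteFamily (C≡ P))
      (bad : ∀ j → ¬ KIntersecting P k (member (F j)))
      where

      -- There are `k` levels outside `K`; common points on all of them would make `F j`
      -- k-intersecting.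
      bad-level : ∀ {r} → r + k ≤ₙ d → (K : Fin r → Fin d) → ∀ j →
                  ∃ λ i → (∀ b → i ≢ K b) × ¬ Common i (member (F j))
      bad-level r+k≤d K j
        with g , g-inj , g∉K ← avoiding k K r+k≤d
        = dne λ none → let
            common : ∀ a → Common (g a) (member (F j))
            common = λ a → dne λ ¬c → none (g a , g∉K a , ¬c)
          in bad j ((λ a → proj₁ (common a) , g a) , (λ a → proj₂ (common a)) , g-inj)

      member-of : (∀ j → Fin (size (F j))) → Fin n → Pred (Point d) 0ℓ
      member-of c j = member (F j) (c j)

      -- The invariant after `r` rounds. Only entries of `tuple` at `used` indices matter so far;
      -- the others may still be overwritten. With `r * 2`, the length for `suc r` unfolds to two
      -- more entries by computation.
      record Killing (r : ℕ) : Set₁ where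
        field
          tuple           : ∀ j → Fin (size (F j))
          killed          : Fin r → Fin d
          killed-distinct : Injective _≡_ _≡_ killed
          used            : Fin (r * 2) → Fin n
          kills           : ∀ s → ∃₂ λ a b → DisjointAt (killed s)
                              (member-of tuple (used a)) (member-of tuple (used b))

      open Killing

      start : Killing 0
      start = record
        -- The first member of each family serves as a placeholder.
        { tuple = λ j → fromℕ< (nonempty (F j)) ; killed = λ () ; killed-distinct = λ { {()} }
        ; used = λ () ; kills = λ () }

      extend : ∀ {r} → (κ : Killing r) → ∀ {i j j′} → j ≢ j′ →
               (∀ b → i ≢ killed κ b) → (∀ b → j ≢ used κ b) → (∀ b → j′ ≢ used κ b) →
               ¬ Common i (member (F j)) → ¬ Common i (member (F j′)) → Killing (ℕ.suc r)
      extend {r} κ {i} {j} {j′} j≢j′ i∉K j∉U j′∉U badj badj′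
        with a , b , disj ← separate (F j) (F j′) badj badj′
        = record
        { tuple = c ; killed = i ∷ killed κ ; killed-distinct = distinct
        ; used = j ∷ j′ ∷ used κ ; kills = kills′ }
        where
        c′ c : ∀ j → Fin (size (F j))
        c′ = update (tuple κ) j a
        c  = update c′ j′ b

        c-old : ∀ u → c (used κ u) ≡ tuple κ (used κ u)
        c-old u = trans (update-minimal c′ j′ b (j′∉U u)) (update-minimal (tuple κ) j a (j∉U u))

        c-j : c j ≡ a
        c-j = trans (update-minimal c′ j′ b (j≢j′ ∘ sym)) (update-updates (tuple κ) j a)

        kills′ : ∀ s → ∃₂ λ u v → DisjointAt ((i ∷ killed κ) s)
                   (member-of c ((j ∷ j′ ∷ used κ) u)) (member-of c ((j ∷ j′ ∷ used κ) v))
        kills′ Fin.zero = Fin.zero , Fin.suc Fin.zero , new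
          where
          new : DisjointAt i (member-of c j) (member-of c j′)
          new rewrite c-j | update-updates c′ j′ b = disj
        kills′ (Fin.suc s) with u , v , old ← kills κ s = Fin.suc (Fin.suc u) , Fin.suc (Fin.suc v) , old′
          where
          old′ : DisjointAt (killed κ s) (member-of c (used κ u)) (member-of c (used κ v))
          old′ rewrite c-old u | c-old v = old

        distinct : Injective _≡_ _≡_ (i ∷ killed κ)
        distinct {Fin.zero}  {Fin.zero}  _  = refl
        distinct {Fin.zero}  {Fin.suc t} eq = contradiction eq (i∉K t)
        distinct {Fin.suc s} {Fin.zero}  eq = contradiction (sym eq) (i∉K s)
        distinct {Fin.suc s} {Fin.suc t} eq = cong Fin.suc (killed-distinct κ eq)

      killing : ∀ r → r + k ≤ₙ ℕ.suc d → Killing r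
      killing ℕ.zero _ = start
      -- The bound `suc d` admits one round beyond `d - k`; at its start `r + k ≤ d` still holds, as
      -- `bad-level` requires.
      killing (ℕ.suc r) (s≤s r+k≤d) = step
        where
        r≤d : r ≤ₙ d
        r≤d = ℕ.m+n≤o⇒m≤o r r+k≤d

        r+t≡1+d : r + ℕ.suc (d ∸ r) ≡ ℕ.suc d
        r+t≡1+d = trans (ℕ.+-suc r (d ∸ r)) (cong ℕ.suc (ℕ.m+[n∸m]≡n r≤d))

        d<r+t : d ℕ.< r + ℕ.suc (d ∸ r)
        d<r+t = ℕ.≤-reflexive (sym r+t≡1+d)

        -- The source of the bound: `2r + (d - r + 1) = d + r + 1`, which is at most `2d - k + 1`
        -- since `r ≤ d - k`.
        enough-families : r * 2 + ℕ.suc (d ∸ r) ≤ₙ n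
        enough-families = ℕ.+-cancelʳ-≤ k _ _ (begin
          r * 2 + ℕ.suc (d ∸ r) + k      ≡⟨ cong (λ e → e + ℕ.suc (d ∸ r) + k) r*2≡r+r ⟩
          r + r + ℕ.suc (d ∸ r) + k      ≡⟨ cong (_+ k) (ℕ.+-assoc r r _) ⟩
          r + (r + ℕ.suc (d ∸ r)) + k    ≡⟨ cong (λ e → r + e + k) r+t≡1+d ⟩
          r + ℕ.suc d + k                ≡⟨ cong (_+ k) (ℕ.+-comm r (ℕ.suc d)) ⟩
          ℕ.suc d + r + k                ≡⟨ ℕ.+-assoc (ℕ.suc d) r k ⟩
          ℕ.suc d + (r + k)              ≤⟨ ℕ.+-monoʳ-≤ (ℕ.suc d) r+k≤d ⟩
          ℕ.suc d + d                    ≤⟨ d+d<n+k ⟩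
          n + k                          ∎)
          where
          open ℕ.≤-Reasoning
          r*2≡r+r : r * 2 ≡ r + r
          r*2≡r+r = trans (ℕ.*-comm r 2) (cong (r +_) (ℕ.+-identityʳ r))

        κ : Killing r
        κ = killing r (ℕ.m≤n⇒m≤1+n r+k≤d)

        level-of : ∀ j → ∃ λ i → (∀ b → i ≢ killed κ b) × ¬ Common i (member (F j))
        level-of = bad-level r+k≤d (killed κ)

        step : Killing (ℕ.suc r)
        step
          with J , J-inj , J∉U ← avoiding (ℕ.suc (d ∸ r)) (used κ) enough-families
          with s , t , s≢t , eq ← pigeonhole-avoiding {g = λ s → proj₁ (level-of (J s))}
                 d<r+t (killed-distinct κ) (λ s → proj₁ (proj₂ (level-of (J s))))
          = let i , i∉K , badₛ = level-of (J s)
                _ , _   , badₜ = level-of (J t)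
            in extend κ (s≢t ∘ J-inj) i∉K (J∉U s) (J∉U t) badₛ
                 (subst (λ i → ¬ Common i (member (F (J t)))) (sym eq) badₜ)

      -- No common point of the tuple lies on any of the `d - k + 1` killed levels, so `k` such
      -- points cannot have distinct levels among `d`.
      non-k-intersecting-tuple : ∃ λ c → ¬ KIntersecting P k (member-of c)
      non-k-intersecting-tuple = tuple κ , λ { (p , p∈ , p-inj) → let
          avoids : ∀ a b → level (p a) ≢ killed κ b
          avoids = λ a b eq → let u , v , disj = kills κ b in
            subst (λ i → DisjointAt i (member-of (tuple κ) (used κ u)) (member-of (tuple κ) (used κ v)))
              (sym eq) disj (proj₁ (p a))
              (proj₂ (p∈ a) (used κ u)) (proj₂ (p∈ a) (used κ v))
          a , b , a≢b , eq = pigeonhole-avoiding (ℕ.≤-reflexive (sym r+k≡1+d)) (killed-distinct κ) avoids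
        in a≢b (p-inj eq) }
        where
        r+k≡1+d : ℕ.suc (d ∸ k) + k ≡ ℕ.suc d
        r+k≡1+d = cong ℕ.suc (ℕ.m∸n+n≡m k≤d)

        κ : Killing (ℕ.suc (d ∸ k))
        κ = killing _ (ℕ.≤-reflexive r+k≡1+d)

    -- The bound and the colorful Helly number.

    colorfulHelly : ∀ {k n} → k ≤ₙ d → d + d ℕ.< n + k → ColorfulHelly P (C≡ P) k n
    colorfulHelly k≤d d+d<n+k F tuples = dne λ none →
      let c , ¬int = non-k-intersecting-tuple k≤d d+d<n+k F (λ j int → none (j , int))
      in ¬int (tuples c)

theorem7 : ExcludedMiddle (suc 0ℓ) →
    (d : ℕ) → 1 ≤ₙ d →
    (P : Pred (Point d) 0ℓ) → P Respects _≈ₚ_ →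
    (k : ℕ) → 1 ≤ₙ k → k ≤ₙ d →
    (∃ λ h → IsColorfulHellyNumber P (C≡ P) k h × h ≤ₙ 2 * d ∸ k + 1)
    × ColorfulHelly P (C≡ P) k (2 * d ∸ k + 1)
theorem7 em d _ P _ k _ k≤d = number , helly-bound
  where
  n : ℕ
  n = 2 * d ∸ k + 1

  -- Subtraction-free form of the bound; truncation is harmless since `k ≤ d ≤ 2 * d`.
  d+d<n+k : d + d ℕ.< n + k
  d+d<n+k = ℕ.≤-reflexive (sym (begin
    2 * d ∸ k + 1 + k       ≡⟨ cong (_+ k) (ℕ.+-comm (2 * d ∸ k) 1) ⟩
    ℕ.suc (2 * d ∸ k + k)   ≡⟨ cong ℕ.suc (ℕ.m∸n+n≡m (ℕ.≤-trans k≤d (ℕ.m≤m+n d _))) ⟩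
    ℕ.suc (2 * d)           ≡⟨ cong (λ e → ℕ.suc (d + e)) (ℕ.+-identityʳ d) ⟩
    ℕ.suc (d + d)           ∎))
    where open ≡-Reasoning

  helly-bound : ColorfulHelly P (C≡ P) k n
  helly-bound = Classical.colorfulHelly em P k≤d d+d<n+k

  number : ∃ λ h → IsColorfulHellyNumber P (C≡ P) k h × h ≤ₙ n
  -- Positivity is part of the minimised property, so that 0 is excluded; `n` qualifies because of
  -- its `+ 1`.
  number with h , (1≤h , hellyₕ) , h≤n , min ←
      least em {λ h → 1 ≤ₙ h × ColorfulHelly P (C≡ P) k h} n (ℕ.m≤n+m 1 (2 * d ∸ k) , helly-bound) =
    h , record { positive = 1≤h ; helly = hellyₕ ; minimal = λ m 1≤m hellyₘ → min m (1≤m , hellyₘ) } , h≤n
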